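{- Let $\mathcal{R}$ be a relational domain over the finite set of variables $\mathcal{X}$ such that $(r_1\sqcup r_2)|_p = r_1|_p\sqcup r_2|_p$ for all $r_1,r_2\in\mathcal{R}$ and all $p\in[\mathcal{X}]_2$. For $r\in\mathcal{R}$ put $\overline{r}=\mathop{\sqcap}_{p\in[\mathcal{X}]_2} r|_p$, and let $\mathcal{R}_2=\{\overline{r}\mid r\in\mathcal{R}\}$, ordered by the ordering inherited from $\mathcal{R}$. Then the following holds: 1. $r=\overline{r}$ for every $r=\mathop{\sqcap}_{p\in[\mathcal{X}]_2}s_p$ with $s_p\in\mathcal{R}^p$ for all $p\in[\mathcal{X}]_2$; i.e., all such meets are contained in $\mathcal{R}_2$. 2. For $r_1,r_2\in\mathcal{R}_2$, the meet $r_1\sqcap r_2$ taken in $\mathcal{R}$ is in $\mathcal{R}_2$. 3. The binary least upper bound operation $\sqcup_2$ in $\mathcal{R}_2$ exists and is given by $r_1\sqcup_2 r_2=\mathop{\sqcap}_{p\in[\mathcal{X}]_2}(r_1|_p\sqcup r_2|_p)$. 4. For $r\in\mathcal{R}_2$ and $Y\subseteq\mathcal{X}$, the best approximation in $\mathcal{R}_2$ (i.e., the least element of $\mathcal{R}_2$ that is $\sqsupseteq r|_Y$) of the restriction $r|_Y$, denoted $r|_{Y,2}$, is given by $r|_{Y,2}=\mathop{\sqcap}_{p\in[\mathcal{X}]_2} r|_{p\cap Y}$. 5. The partial order $\mathcal{R}_2$ with the binary greatest lower bounds and least upper bounds given in 2 and 3 (and the restriction $r\mapsto r|_{Y,2}$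 from 4) is a 2-decomposable relational domain.
   Context: $\mathcal{X}$ is a finite set of variables and $[\mathcal{X}]_2$ denotes the set of all non-empty subsets ("clusters") of $\mathcal{X}$ of size at most $2$. A relational domain (over $\mathcal{X}$) is a bounded lattice $(\mathcal{R},\sqsubseteq,\bot,\top,\sqcap,\sqcup)$ (not necessarily complete) together with, for each $Y\subseteq\mathcal{X}$, a monotone restriction operation $r\mapsto r|_Y$ on $\mathcal{R}$ satisfying: $r|_{\mathcal{X}}=r$; $r|_\emptyset=\bot$ if $r=\bot$ and $r|_\emptyset=\top$ otherwise; $r|_{Y_1}\sqsupseteq r|_{Y_2}$ whenever $Y_1\subseteq Y_2$; and $(r|_{Y_1})|_{Y_2}=r|_{Y_1\cap Y_2}$. (A relational domain also comes with monotone transformers for assignments and guards over some expression and condition language, which are not constrained by any axiom; being a relational domain is understood here as a statement about the bounded lattice and the restriction.) For $Y\subseteq\mathcal{X}$, $\mathcal{R}^Y=\{r|_Y\mid r\in\mathcal{R}\}$. A relational domain $\mathcal{R}$ is 2-decomposable if $r=\mathop{\sqcap}_{p\in[\mathcal{X}]_2} r|_p$ for all $r\in\mathcal{R}$, and $(r_1\sqcup r_2)|_p=r_1|_p\sqcup r_2|_p$ for all $r_1,r_2\in\mathcal{R}$ and $p\in[\mathcal{X}]_2$. -}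

module Defs where

open import Algebra.Core using (Op₂)
open import Data.Fin.Subset using (Subset; Side; Nonempty; inside; outside; ∣_∣; _∩_; _⊆_)
  renaming (⊤ to full; ⊥ to ∅)
open import Data.Fin.Subset.Properties using (nonempty?)
open import Data.Irrelevant using ([_])
open import Data.List.Base as List using (List; foldr; mapMaybe; cartesianProductWith)
open import Data.List.Membership.Propositional using () renaming (_∈_ to _∈ˡ_)
open import Data.List.Membership.Propositional.Properties using (∈-cartesianProductWith⁺)
import Data.List.Relation.Unary.Any as Any
open import Data.List.Relation.Unary.Any.Properties using (mapMaybe⁺; map⁺)
import Data.Maybe.Base as Maybe
open import Data.Maybe.Base using (Maybe)
import Data.Maybe.Relation.Unary.Any as MAny
open import Data.Nat.Base using (ℕ; zero; suc; _≤_)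
open import Data.Nat.Properties using (_≤?_)
open import Data.Product.Base using (Σ; ∃-syntax; _×_; _,_; proj₁)
open import Data.Refinement.Base using (Refinement; value; _,_)
open import Data.Vec.Base using ([]; _∷_)
open import Function.Base using (_on_)
open import Level using (Level) renaming (_⊔_ to _⊔ˡ_; suc to sucˡ)
open import Relation.Binary.Core using (Rel)
open import Relation.Binary.Lattice.Structures using (IsBoundedLattice)
open import Relation.Binary.PropositionalEquality.Core using (_≡_; refl)
open import Relation.Nullary using (¬_; Dec; yes; no)
open import Relation.Nullary.Decidable using (_×-dec_; dec⇒maybe)
open import Relation.Nullary.Negation using (contradiction-irr)
open import Relation.Unary using (Pred; _∈_)

-- The finite set of variables is Fin n; sets of variables are Subset n.

IsCluster : ∀ {n} → Subset n → Set
IsCluster p = Nonempty p × ∣ p ∣ ≤ 2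

-- The proof component of a Refinement is irrelevant, so a family indexed
-- by clusters has exactly one member for each underlying subset.
Cluster : ℕ → Set
Cluster n = Refinement (Subset n) IsCluster

isCluster? : ∀ {n} (p : Subset n) → Dec (IsCluster p)
isCluster? p = nonempty? p ×-dec (∣ p ∣ ≤? 2)

toCluster : ∀ {n} → Subset n → Maybe (Cluster n)
toCluster p = Maybe.map (λ c → p , [ c ]) (dec⇒maybe (isCluster? p))

sides : List Side
sides = outside List.∷ inside List.∷ List.[]

subsets : ∀ n → List (Subset n)
subsets zero    = List.[ [] ]
subsets (suc n) = cartesianProductWith _∷_ sides (subsets n)

clusters : ∀ n → List (Cluster n)
clusters n = mapMaybe toCluster (subsets n)

subsets-complete : ∀ {n} (p : Subset n) → p ∈ˡ subsets n
subsets-complete []            = Any.here refl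
subsets-complete (outside ∷ p) =
  ∈-cartesianProductWith⁺ _∷_ {xs = sides} (Any.here refl) (subsets-complete p)
subsets-complete (inside ∷ p)  =
  ∈-cartesianProductWith⁺ _∷_ {xs = sides} (Any.there (Any.here refl)) (subsets-complete p)

clusters-complete : ∀ {n} (p : Cluster n) → p ∈ˡ clusters n
clusters-complete {n} (p , [ c ]) =
  mapMaybe⁺ toCluster (subsets n)
    (map⁺ (Any.map (λ { refl → found }) (subsets-complete p)))
  where
  found : MAny.Any ((p , [ c ]) ≡_) (toCluster p)
  found with isCluster? p
  ... | yes _ = MAny.just refl
  ... | no ¬c = contradiction-irr c ¬c

-- The finite meet over all clusters; it is ⊤ when there are no variables.
⨅[_,_] : ∀ {a n} {A : Set a} → Op₂ A → A → (Cluster n → A) → A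
⨅[_,_] {n = n} _⊓_ ⊤ s = foldr _⊓_ ⊤ (List.map s (clusters n))

module _ {a ℓ₁ ℓ₂ : Level} {A : Set a} {n : ℕ}
         (_≈_ : Rel A ℓ₁) (_⊑_ : Rel A ℓ₂)
         (_⊔_ _⊓_ : Op₂ A) (⊤ ⊥ : A)
         (_↾_ : A → Subset n → A) where

  -- The transformers for assignments and guards carry no axioms relating
  -- them to the lattice or the restriction, and are left out.
  record IsRelationalDomain : Set (a ⊔ˡ ℓ₁ ⊔ˡ ℓ₂) where
    field
      isBoundedLattice : IsBoundedLattice _≈_ _⊑_ _⊔_ _⊓_ ⊤ ⊥
      ↾-mono           : ∀ Y {r s} → r ⊑ s → (r ↾ Y) ⊑ (s ↾ Y)
      ↾-full           : ∀ r → (r ↾ full) ≈ r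
      ↾-∅-⊥            : ∀ r → r ≈ ⊥ → (r ↾ ∅) ≈ ⊥
      ↾-∅-⊤            : ∀ r → ¬ (r ≈ ⊥) → (r ↾ ∅) ≈ ⊤
      ↾-antitone       : ∀ r {Y₁ Y₂} → Y₁ ⊆ Y₂ → (r ↾ Y₂) ⊑ (r ↾ Y₁)
      ↾-∩              : ∀ r Y₁ Y₂ → ((r ↾ Y₁) ↾ Y₂) ≈ (r ↾ (Y₁ ∩ Y₂))

    open IsBoundedLattice isBoundedLattice public

module _ {a ℓ : Level} {A : Set a} {n : ℕ}
         (_≈_ : Rel A ℓ) (_⊔_ : Op₂ A) (_↾_ : A → Subset n → A) where

  ClusterRestrictionPreservesJoins : Set (a ⊔ˡ ℓ)
  ClusterRestrictionPreservesJoins =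
    ∀ r₁ r₂ (p : Cluster n) →
    ((r₁ ⊔ r₂) ↾ value p) ≈ ((r₁ ↾ value p) ⊔ (r₂ ↾ value p))

  record IsTwoDecomposable (_⊓_ : Op₂ A) (⊤ : A) : Set (a ⊔ˡ ℓ) where
    field
      decompose         : ∀ r → r ≈ ⨅[ _⊓_ , ⊤ ] (λ p → r ↾ value p)
      ↾-preserves-joins : ClusterRestrictionPreservesJoins

record RelationalDomain (n : ℕ) (c ℓ₁ ℓ₂ : Level) : Set (sucˡ (c ⊔ˡ ℓ₁ ⊔ˡ ℓ₂)) where
  infixl 8 _↾_
  infixr 7 _⊓_
  infixr 6 _⊔_
  infix  4 _≈_ _⊑_ _≈₂_ _⊑₂_
  field
    Carrier            : Set c
    _≈_                : Rel Carrier ℓ₁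
    _⊑_                : Rel Carrier ℓ₂
    _⊔_                : Op₂ Carrier
    _⊓_                : Op₂ Carrier
    ⊤                  : Carrier
    ⊥                  : Carrier
    _↾_                : Carrier → Subset n → Carrier
    isRelationalDomain : IsRelationalDomain _≈_ _⊑_ _⊔_ _⊓_ ⊤ ⊥ _↾_

  open IsRelationalDomain isRelationalDomain public

  ⨅ : (Cluster n → Carrier) → Carrier
  ⨅ = ⨅[ _⊓_ , ⊤ ]

  ℛ^ : Subset n → Pred Carrier (c ⊔ˡ ℓ₁)
  ℛ^ Y s = ∃[ r ] s ≈ r ↾ Y

  closure : Carrier → Carrier
  closure r = ⨅ (λ p → r ↾ value p)

  ℛ₂ : Pred Carrier (c ⊔ˡ ℓ₁)
  ℛ₂ s = ∃[ r ] s ≈ closure r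

  Carrier₂ : Set (c ⊔ˡ ℓ₁)
  Carrier₂ = Σ Carrier ℛ₂

  _≈₂_ : Rel Carrier₂ ℓ₁
  _≈₂_ = _≈_ on proj₁

  _⊑₂_ : Rel Carrier₂ ℓ₂
  _⊑₂_ = _⊑_ on proj₁

  join₂ : Op₂ Carrier
  join₂ r₁ r₂ = ⨅ (λ p → (r₁ ↾ value p) ⊔ (r₂ ↾ value p))

  restrict₂ : Carrier → Subset n → Carrier
  restrict₂ r Y = ⨅ (λ p → r ↾ (value p ∩ Y))

  liftOp₂ : (_∙_ : Op₂ Carrier) →
            (∀ {r₁ r₂} → r₁ ∈ ℛ₂ → r₂ ∈ ℛ₂ → (r₁ ∙ r₂) ∈ ℛ₂) → Op₂ Carrier₂
  liftOp₂ _∙_ closed (r₁ , r₁∈) (r₂ , r₂∈) = (r₁ ∙ r₂) , closed r₁∈ r₂∈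

  liftRestriction₂ : (_⇂_ : Carrier → Subset n → Carrier) →
                     (∀ {r} → r ∈ ℛ₂ → ∀ Y → (r ⇂ Y) ∈ ℛ₂) →
                     Carrier₂ → Subset n → Carrier₂
  liftRestriction₂ _⇂_ closed (r , r∈) Y = (r ⇂ Y) , closed r∈ Y

{-# OPTIONS --safe #-}
module Submission where

-- The map r ↦ closure r is a closure operator, and ℛ₂ is its set of fixed
-- points.  It is extensive because r = r ↾ full ⊑ r ↾ p, monotone because
-- restrictions and finite meets are, and idempotent because any meet r of
-- elements s p of ℛ^ p already dominates its closure: r ⊑ s p gives
-- r ↾ p ⊑ s p ↾ p ≈ s p.  Hence ℛ₂ is closed under meets, and the best
-- approximation of x in ℛ₂ is closure x.  Least upper bounds and
-- restrictions in ℛ₂ are therefore closure (r₁ ⊔ r₂) and closure (r ↾ Y);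
-- the first is join₂ r₁ r₂ because restriction to clusters preserves joins,
-- the second is restrict₂ r Y because (r ↾ Y) ↾ p ≈ r ↾ (p ∩ Y).
--
-- What makes ℛ₂ a 2-decomposable relational domain is that taking the
-- closure does not change restrictions to subsets of clusters
-- (closure-↾-cluster): for Y ⊆ p, closure r ↾ Y ⊑ (r ↾ p) ↾ Y ≈ r ↾ Y.
-- This yields the composition law for restrictions, since p ∩ Y₂ is always
-- contained in the cluster p, and it yields the preservation of joins.

open import Defs
open import Data.Fin.Subset using (Subset; _∩_; _⊆_) renaming (⊤ to full; ⊥ to ∅)
open import Data.Fin.Subset.Properties
  using (⊆-antisym; ⊆-max; ⊆-min; ⊆-refl; p∩q⊆p; p∩q⊆q; x∈p∩q⁺; ∩-comm; ∩-assoc; ∩-idem)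
open import Data.List.Base using (foldr; map; []; _∷_)
open import Data.List.Membership.Propositional using () renaming (_∈_ to _∈ˡ_)
open import Data.List.Relation.Unary.Any using (here; there)
open import Data.Nat.Base using (ℕ)
open import Data.Product.Base using (_×_; Σ-syntax; ∃-syntax; proj₁; proj₂; _,_)
open import Data.Refinement.Base using (value)
open import Level using () renaming (_⊔_ to _⊔ˡ_)
import Relation.Binary.Construct.On as On
open import Relation.Binary.Lattice.Bundles using (BoundedLattice)
open import Relation.Binary.Lattice.Definitions using (Supremum; Infimum)
open import Relation.Binary.Lattice.Structures using (IsBoundedLattice)
open import Relation.Binary.PropositionalEquality.Core as ≡ using (_≡_)
import Relation.Binary.Lattice.Properties.JoinSemilattice as JoinSemilatticeProperties
import Relation.Binary.Reasoning.PartialOrder as PosetReasoning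
open import Relation.Nullary using (¬_)
open import Relation.Unary using (_∈_)

-- In any bounded lattice, the iterated meet over the list of clusters is the
-- greatest lower bound of a family indexed by clusters.
module ClusterMeet (n : ℕ) {c ℓ₁ ℓ₂} (L : BoundedLattice c ℓ₁ ℓ₂) where
  open BoundedLattice L

  ⨅-lower : ∀ (s : Cluster n → Carrier) p → ⨅[ _∧_ , ⊤ ] s ≤ s p
  ⨅-lower s p = go (clusters-complete p)
    where
    go : ∀ {ps} → p ∈ˡ ps → foldr _∧_ ⊤ (map s ps) ≤ s p
    go (here ≡.refl) = x∧y≤x _ _
    go (there p∈ps)  = trans (x∧y≤y _ _) (go p∈ps)

  ⨅-greatest : ∀ (s : Cluster n → Carrier) {x} → (∀ p → x ≤ s p) → x ≤ ⨅[ _∧_ , ⊤ ] s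
  ⨅-greatest s {x} x≤s = go (clusters n)
    where
    go : ∀ ps → x ≤ foldr _∧_ ⊤ (map s ps)
    go []       = maximum x
    go (p ∷ ps) = ∧-greatest (x≤s p) (go ps)

  ⨅-mono : ∀ {s t : Cluster n → Carrier} → (∀ p → s p ≤ t p) →
           ⨅[ _∧_ , ⊤ ] s ≤ ⨅[ _∧_ , ⊤ ] t
  ⨅-mono s≤t = ⨅-greatest _ (λ p → trans (⨅-lower _ p) (s≤t p))

  ⨅-cong : ∀ {s t : Cluster n → Carrier} → (∀ p → s p ≈ t p) →
           ⨅[ _∧_ , ⊤ ] s ≈ ⨅[ _∧_ , ⊤ ] t
  ⨅-cong s≈t = antisym (⨅-mono (λ p → reflexive (s≈t p)))
                       (⨅-mono (λ p → reflexive (Eq.sym (s≈t p))))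

module Closure {n c ℓ₁ ℓ₂} (R : RelationalDomain n c ℓ₁ ℓ₂) where
  open RelationalDomain R

  boundedLattice : BoundedLattice c ℓ₁ ℓ₂
  boundedLattice = record { isBoundedLattice = isBoundedLattice }

  open BoundedLattice boundedLattice public
    using (poset; joinSemilattice)
  open JoinSemilatticeProperties joinSemilattice public using (∨-monotonic)
  open ClusterMeet n boundedLattice public
  open PosetReasoning poset

  -- Restriction.

  ↾-cong : ∀ Y {r s} → r ≈ s → r ↾ Y ≈ s ↾ Y
  ↾-cong Y r≈s = antisym (↾-mono Y (reflexive r≈s)) (↾-mono Y (reflexive (Eq.sym r≈s)))

  ↾-resp-≡ : ∀ r {Y Z} → Y ≡ Z → r ↾ Y ≈ r ↾ Z
  ↾-resp-≡ r ≡.refl = Eq.refl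

  ↾-extensive : ∀ r Y → r ⊑ r ↾ Y
  ↾-extensive r Y = begin
    r        ≈⟨ ↾-full r ⟨
    r ↾ full ≤⟨ ↾-antitone r (⊆-max Y) ⟩
    r ↾ Y    ∎

  ↾-⊆ : ∀ r {Y Z} → Y ⊆ Z → (r ↾ Z) ↾ Y ≈ r ↾ Y
  ↾-⊆ r {Y} {Z} Y⊆Z = Eq.trans (↾-∩ r Z Y) (↾-resp-≡ r
    (⊆-antisym (p∩q⊆q Z Y) (λ x∈Y → x∈p∩q⁺ (Y⊆Z x∈Y , x∈Y))))

  ⊥↾-≈-⊥ : ∀ Y → ⊥ ↾ Y ≈ ⊥
  ⊥↾-≈-⊥ Y = antisym
    (begin
      ⊥ ↾ Y ≤⟨ ↾-antitone ⊥ (⊆-min Y) ⟩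
      ⊥ ↾ ∅ ≈⟨ ↾-∅-⊥ ⊥ Eq.refl ⟩
      ⊥     ∎)
    (minimum (⊥ ↾ Y))

  -- The closure operator.

  closure-extensive : ∀ r → r ⊑ closure r
  closure-extensive r = ⨅-greatest _ (λ p → ↾-extensive r (value p))

  closure-mono : ∀ {r s} → r ⊑ s → closure r ⊑ closure s
  closure-mono r⊑s = ⨅-mono (λ p → ↾-mono (value p) r⊑s)

  closure-cong : ∀ {r s} → r ≈ s → closure r ≈ closure s
  closure-cong r≈s = ⨅-cong (λ p → ↾-cong (value p) r≈s)

  -- Every meet of elements s p of ℛ^ p is a fixed point of the closure.
  closure-of-meet : ∀ r (s : Cluster n → Carrier) → (∀ p → s p ∈ ℛ^ (value p)) →
                    r ≈ ⨅ s → r ≈ closure r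
  closure-of-meet r s s∈ r≈⨅s = antisym (closure-extensive r) (begin
    closure r ≤⟨ ⨅-mono r↾p⊑sp ⟩
    ⨅ s       ≈⟨ r≈⨅s ⟨
    r         ∎)
    where
    r↾p⊑sp : ∀ p → r ↾ value p ⊑ s p
    r↾p⊑sp p with t , sp≈t↾p ← s∈ p = begin
      r ↾ value p             ≤⟨ ↾-mono (value p) (trans (reflexive r≈⨅s) (⨅-lower s p)) ⟩
      s p ↾ value p           ≈⟨ ↾-cong (value p) sp≈t↾p ⟩
      (t ↾ value p) ↾ value p ≈⟨ ↾-⊆ t ⊆-refl ⟩
      t ↾ value p             ≈⟨ sp≈t↾p ⟨
      s p                     ∎

  closure-idem : ∀ r → closure r ≈ closure (closure r)
  closure-idem r = closure-of-meet (closure r) _ (λ p → r , Eq.refl) Eq.refl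

  closure∈ℛ₂ : ∀ r → closure r ∈ ℛ₂
  closure∈ℛ₂ r = r , Eq.refl

  ℛ₂⇒fixed : ∀ {r} → r ∈ ℛ₂ → closure r ≈ r
  ℛ₂⇒fixed {r} (t , r≈t̅) = begin-equality
    closure r           ≈⟨ closure-cong r≈t̅ ⟩
    closure (closure t) ≈⟨ closure-idem t ⟨
    closure t           ≈⟨ r≈t̅ ⟨
    r                   ∎

  fixed⇒ℛ₂ : ∀ {r} → closure r ⊑ r → r ∈ ℛ₂
  fixed⇒ℛ₂ {r} r̅⊑r = r , antisym (closure-extensive r) r̅⊑r

  -- closure x is the best approximation of x in ℛ₂.
  closure-least : ∀ {x s} → s ∈ ℛ₂ → x ⊑ s → closure x ⊑ s
  closure-least s∈ x⊑s = trans (closure-mono x⊑s) (reflexive (ℛ₂⇒fixed s∈))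

  -- Taking the closure adds nothing to what is visible inside a cluster.
  -- Y may be empty here: the cluster p containing Y then only witnesses that
  -- there is a variable, without which closure r would be ⊤.
  closure-↾-cluster : ∀ r {Y} (p : Cluster n) → Y ⊆ value p → closure r ↾ Y ⊑ r ↾ Y
  closure-↾-cluster r {Y} p Y⊆p = begin
    closure r ↾ Y     ≤⟨ ↾-mono Y (⨅-lower _ p) ⟩
    (r ↾ value p) ↾ Y ≈⟨ ↾-⊆ r Y⊆p ⟩
    r ↾ Y             ∎

  -- Meets and restrictions in ℛ₂.

  ⊓-closed : ∀ {r₁ r₂} → r₁ ∈ ℛ₂ → r₂ ∈ ℛ₂ → (r₁ ⊓ r₂) ∈ ℛ₂
  ⊓-closed r₁∈ r₂∈ = fixed⇒ℛ₂
    (∧-greatest (closure-least r₁∈ (x∧y≤x _ _)) (closure-least r₂∈ (x∧y≤y _ _)))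

  -- Restricting in ℛ₂ is restricting in ℛ and then taking the best
  -- approximation.
  restrict₂-closure : ∀ r Y → restrict₂ r Y ≈ closure (r ↾ Y)
  restrict₂-closure r Y = ⨅-cong λ p → begin-equality
    r ↾ (value p ∩ Y)   ≈⟨ ↾-resp-≡ r (∩-comm (value p) Y) ⟩
    r ↾ (Y ∩ value p)   ≈⟨ ↾-∩ r Y (value p) ⟨
    (r ↾ Y) ↾ value p   ∎

  restrict₂-closed : ∀ {r} → r ∈ ℛ₂ → ∀ Y → restrict₂ r Y ∈ ℛ₂
  restrict₂-closed {r} _ Y = r ↾ Y , restrict₂-closure r Y

  ↾⊑restrict₂ : ∀ r Y → r ↾ Y ⊑ restrict₂ r Y
  ↾⊑restrict₂ r Y = trans (closure-extensive (r ↾ Y)) (reflexive (Eq.sym (restrict₂-closure r Y)))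

  restrict₂-least : ∀ {r s} Y → s ∈ ℛ₂ → r ↾ Y ⊑ s → restrict₂ r Y ⊑ s
  restrict₂-least {r} Y s∈ r↾Y⊑s = trans (reflexive (restrict₂-closure r Y)) (closure-least s∈ r↾Y⊑s)

  restrict₂-mono : ∀ Y {r s} → r ⊑ s → restrict₂ r Y ⊑ restrict₂ s Y
  restrict₂-mono Y r⊑s = ⨅-mono (λ p → ↾-mono (value p ∩ Y) r⊑s)

  restrict₂-full : ∀ {r} → r ∈ ℛ₂ → restrict₂ r full ≈ r
  restrict₂-full {r} r∈ = begin-equality
    restrict₂ r full   ≈⟨ restrict₂-closure r full ⟩
    closure (r ↾ full) ≈⟨ closure-cong (↾-full r) ⟩
    closure r          ≈⟨ ℛ₂⇒fixed r∈ ⟩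
    r                  ∎

  -- The least element of ℛ₂ is closure ⊥.  It equals ⊥ as soon as there is
  -- a cluster; the meet over all clusters supplies one wherever it is needed.
  restrict₂-∅-⊥ : ∀ r → r ≈ closure ⊥ → restrict₂ r ∅ ≈ closure ⊥
  restrict₂-∅-⊥ r r≈⊥̅ = antisym
    (⨅-mono λ p → begin
      r ↾ (value p ∩ ∅)         ≈⟨ ↾-cong _ r≈⊥̅ ⟩
      closure ⊥ ↾ (value p ∩ ∅) ≤⟨ closure-↾-cluster ⊥ p (p∩q⊆p (value p) ∅) ⟩
      ⊥ ↾ (value p ∩ ∅)         ≈⟨ ⊥↾-≈-⊥ _ ⟩
      ⊥                         ≤⟨ minimum (⊥ ↾ value p) ⟩
      ⊥ ↾ value p               ∎)
    (begin
      closure ⊥       ≤⟨ closure-mono (minimum (r ↾ ∅)) ⟩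
      closure (r ↾ ∅) ≈⟨ restrict₂-closure r ∅ ⟨
      restrict₂ r ∅   ∎)

  restrict₂-∅-⊤ : ∀ {r} → r ∈ ℛ₂ → ¬ (r ≈ closure ⊥) → restrict₂ r ∅ ≈ ⊤
  restrict₂-∅-⊤ {r} r∈ r≉⊥̅ = antisym (maximum _) (begin
    ⊤             ≈⟨ ↾-∅-⊤ r r≉⊥ ⟨
    r ↾ ∅         ≤⟨ ↾⊑restrict₂ r ∅ ⟩
    restrict₂ r ∅ ∎)
    where
    r≉⊥ : ¬ (r ≈ ⊥)
    r≉⊥ r≈⊥ = r≉⊥̅ (Eq.trans (Eq.sym (ℛ₂⇒fixed r∈)) (closure-cong r≈⊥))

  restrict₂-antitone : ∀ r {Y₁ Y₂} → Y₁ ⊆ Y₂ → restrict₂ r Y₂ ⊑ restrict₂ r Y₁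
  restrict₂-antitone r {Y₁} {Y₂} Y₁⊆Y₂ = begin
    restrict₂ r Y₂   ≈⟨ restrict₂-closure r Y₂ ⟩
    closure (r ↾ Y₂) ≤⟨ closure-mono (↾-antitone r Y₁⊆Y₂) ⟩
    closure (r ↾ Y₁) ≈⟨ restrict₂-closure r Y₁ ⟨
    restrict₂ r Y₁   ∎

  restrict₂-∩ : ∀ r Y₁ Y₂ → restrict₂ (restrict₂ r Y₁) Y₂ ≈ restrict₂ r (Y₁ ∩ Y₂)
  restrict₂-∩ r Y₁ Y₂ = antisym
    (⨅-mono λ p → begin
      restrict₂ r Y₁ ↾ (value p ∩ Y₂)   ≈⟨ ↾-cong _ (restrict₂-closure r Y₁) ⟩
      closure (r ↾ Y₁) ↾ (value p ∩ Y₂) ≤⟨ closure-↾-cluster (r ↾ Y₁) p (p∩q⊆p (value p) Y₂) ⟩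
      (r ↾ Y₁) ↾ (value p ∩ Y₂)         ≈⟨ regroup p ⟩
      r ↾ (value p ∩ (Y₁ ∩ Y₂))         ∎)
    (⨅-mono λ p → begin
      r ↾ (value p ∩ (Y₁ ∩ Y₂))         ≈⟨ regroup p ⟨
      (r ↾ Y₁) ↾ (value p ∩ Y₂)         ≤⟨ ↾-mono _ (↾⊑restrict₂ r Y₁) ⟩
      restrict₂ r Y₁ ↾ (value p ∩ Y₂)   ∎)
    where
    regroup : ∀ p → (r ↾ Y₁) ↾ (value p ∩ Y₂) ≈ r ↾ (value p ∩ (Y₁ ∩ Y₂))
    regroup p = begin-equality
      (r ↾ Y₁) ↾ (value p ∩ Y₂) ≈⟨ ↾-∩ r Y₁ (value p ∩ Y₂) ⟩
      r ↾ (Y₁ ∩ (value p ∩ Y₂)) ≈⟨ ↾-resp-≡ r (≡.sym (∩-assoc Y₁ (value p) Y₂)) ⟩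
      r ↾ ((Y₁ ∩ value p) ∩ Y₂) ≈⟨ ↾-resp-≡ r (≡.cong (_∩ Y₂) (∩-comm Y₁ (value p))) ⟩
      r ↾ ((value p ∩ Y₁) ∩ Y₂) ≈⟨ ↾-resp-≡ r (∩-assoc (value p) Y₁ Y₂) ⟩
      r ↾ (value p ∩ (Y₁ ∩ Y₂)) ∎

  restrict₂-⊑-↾ : ∀ r (p : Cluster n) → restrict₂ r (value p) ⊑ r ↾ value p
  restrict₂-⊑-↾ r p = begin
    restrict₂ r (value p)   ≤⟨ ⨅-lower _ p ⟩
    r ↾ (value p ∩ value p) ≈⟨ ↾-resp-≡ r (∩-idem (value p)) ⟩
    r ↾ value p             ∎

-- Joins in ℛ₂, and ℛ₂ as a 2-decomposable relational domain.

module Joins {n c ℓ₁ ℓ₂} (R : RelationalDomain n c ℓ₁ ℓ₂)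
  (↾-⊔ : ClusterRestrictionPreservesJoins (RelationalDomain._≈_ R)
           (RelationalDomain._⊔_ R) (RelationalDomain._↾_ R)) where

  open RelationalDomain R
  open Closure R public
  open PosetReasoning poset

  join₂-closure : ∀ r₁ r₂ → join₂ r₁ r₂ ≈ closure (r₁ ⊔ r₂)
  join₂-closure r₁ r₂ = ⨅-cong (λ p → Eq.sym (↾-⊔ r₁ r₂ p))

  join₂-closed : ∀ {r₁ r₂} → r₁ ∈ ℛ₂ → r₂ ∈ ℛ₂ → join₂ r₁ r₂ ∈ ℛ₂
  join₂-closed {r₁} {r₂} _ _ = r₁ ⊔ r₂ , join₂-closure r₁ r₂

  ⊔⊑join₂ : ∀ r₁ r₂ → r₁ ⊔ r₂ ⊑ join₂ r₁ r₂
  ⊔⊑join₂ r₁ r₂ = trans (closure-extensive _) (reflexive (Eq.sym (join₂-closure r₁ r₂)))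

  join₂-least : ∀ {r₁ r₂ s} → s ∈ ℛ₂ → r₁ ⊑ s → r₂ ⊑ s → join₂ r₁ r₂ ⊑ s
  join₂-least s∈ r₁⊑s r₂⊑s =
    trans (reflexive (join₂-closure _ _)) (closure-least s∈ (∨-least r₁⊑s r₂⊑s))

  -- The operations of ℛ₂.  An element of ℛ₂ is an element of ℛ paired with a
  -- membership proof; order and equality look at the first component only,
  -- so the proofs chosen below are immaterial.
  _⊔₂_ : Carrier₂ → Carrier₂ → Carrier₂
  _⊔₂_ = liftOp₂ join₂ join₂-closed

  _⊓₂_ : Carrier₂ → Carrier₂ → Carrier₂
  _⊓₂_ = liftOp₂ _⊓_ ⊓-closed

  _↾₂_ : Carrier₂ → Subset n → Carrier₂
  _↾₂_ = liftRestriction₂ restrict₂ restrict₂-closed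

  ⊤₂ : Carrier₂
  ⊤₂ = ⊤ , fixed⇒ℛ₂ (maximum (closure ⊤))

  -- When there are no variables, closure ⊥ is ⊤ rather than ⊥.
  ⊥₂ : Carrier₂
  ⊥₂ = closure ⊥ , closure∈ℛ₂ ⊥

  supremum₂ : Supremum _⊑₂_ _⊔₂_
  supremum₂ (r₁ , _) (r₂ , _) =
    trans (x≤x∨y r₁ r₂) (⊔⊑join₂ r₁ r₂) ,
    trans (y≤x∨y r₁ r₂) (⊔⊑join₂ r₁ r₂) ,
    λ (_ , s∈) → join₂-least s∈

  infimum₂ : Infimum _⊑₂_ _⊓₂_
  infimum₂ (r₁ , _) (r₂ , _) = x∧y≤x r₁ r₂ , x∧y≤y r₁ r₂ , λ _ → ∧-greatest

  isBoundedLattice₂ : IsBoundedLattice _≈₂_ _⊑₂_ _⊔₂_ _⊓₂_ ⊤₂ ⊥₂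
  isBoundedLattice₂ = record
    { isLattice = record
      { isPartialOrder = On.isPartialOrder proj₁ isPartialOrder
      ; supremum       = supremum₂
      ; infimum        = infimum₂
      }
    ; maximum = λ (r , _) → maximum r
    ; minimum = λ (r , r∈) → closure-least r∈ (minimum r)
    }

  isRelationalDomain₂ : IsRelationalDomain _≈₂_ _⊑₂_ _⊔₂_ _⊓₂_ ⊤₂ ⊥₂ _↾₂_
  isRelationalDomain₂ = record
    { isBoundedLattice = isBoundedLattice₂
    ; ↾-mono           = λ Y → restrict₂-mono Y
    ; ↾-full           = λ (_ , r∈) → restrict₂-full r∈
    ; ↾-∅-⊥            = λ (r , _) → restrict₂-∅-⊥ r
    ; ↾-∅-⊤            = λ (_ , r∈) → restrict₂-∅-⊤ r∈
    ; ↾-antitone       = λ (r , _) → restrict₂-antitone r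
    ; ↾-∩              = λ (r , _) → restrict₂-∩ r
    }

  boundedLattice₂ : BoundedLattice (c ⊔ˡ ℓ₁) ℓ₁ ℓ₂
  boundedLattice₂ = record { isBoundedLattice = isBoundedLattice₂ }

  private
    module Meet₂ = ClusterMeet n boundedLattice₂

  -- The meet in ℛ₂ lies below restrict₂ x p ⊑ x ↾ p for every cluster p, hence
  -- below closure x, which is x.
  decompose₂ : ∀ r → r ≈₂ ⨅[ _⊓₂_ , ⊤₂ ] (λ p → r ↾₂ value p)
  decompose₂ r@(x , x∈) = antisym
    (Meet₂.⨅-greatest (λ p → r ↾₂ value p) {r}
      (λ p → trans (↾-extensive x (value p)) (↾⊑restrict₂ x (value p))))
    (begin
      proj₁ (⨅[ _⊓₂_ , ⊤₂ ] (λ p → r ↾₂ value p)) ≤⟨ ⨅-greatest _ below-↾ ⟩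
      closure x                                   ≈⟨ ℛ₂⇒fixed x∈ ⟩
      x                                           ∎)
    where
    below-↾ : ∀ p → proj₁ (⨅[ _⊓₂_ , ⊤₂ ] (λ p → r ↾₂ value p)) ⊑ x ↾ value p
    below-↾ p = trans (Meet₂.⨅-lower (λ p → r ↾₂ value p) p) (restrict₂-⊑-↾ x p)

  -- That the restriction of the join lies below the join of the restrictions
  -- is where closure-↾-cluster is needed: it replaces join₂ x y ↾ p by
  -- (x ⊔ y) ↾ p, to which the hypothesis on ℛ applies.
  restrict₂-preserves-joins : ClusterRestrictionPreservesJoins _≈₂_ _⊔₂_ _↾₂_
  restrict₂-preserves-joins r@(x , _) s@(y , _) p = antisym
    (restrict₂-least P (proj₂ ((r ↾₂ P) ⊔₂ (s ↾₂ P))) (begin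
      join₂ x y ↾ P                           ≈⟨ ↾-cong P (join₂-closure x y) ⟩
      closure (x ⊔ y) ↾ P                     ≤⟨ closure-↾-cluster (x ⊔ y) p ⊆-refl ⟩
      (x ⊔ y) ↾ P                             ≈⟨ ↾-⊔ x y p ⟩
      (x ↾ P) ⊔ (y ↾ P)                       ≤⟨ ∨-monotonic (↾⊑restrict₂ x P) (↾⊑restrict₂ y P) ⟩
      restrict₂ x P ⊔ restrict₂ y P           ≤⟨ ⊔⊑join₂ _ _ ⟩
      join₂ (restrict₂ x P) (restrict₂ y P)   ∎))
    (join₂-least (proj₂ ((r ⊔₂ s) ↾₂ P))
      (restrict₂-mono P (proj₁ (supremum₂ r s)))
      (restrict₂-mono P (proj₁ (proj₂ (supremum₂ r s)))))
    where
    P = value p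

  isTwoDecomposable₂ : IsTwoDecomposable _≈₂_ _⊔₂_ _↾₂_ _⊓₂_ ⊤₂
  isTwoDecomposable₂ = record
    { decompose         = decompose₂
    ; ↾-preserves-joins = restrict₂-preserves-joins
    }

theorem1 : ∀ {n c ℓ₁ ℓ₂} (R : RelationalDomain n c ℓ₁ ℓ₂) →
  let open RelationalDomain R in
  ClusterRestrictionPreservesJoins _≈_ _⊔_ _↾_ →
  -- 1
  (∀ r (s : Cluster n → Carrier) → (∀ p → s p ∈ ℛ^ (value p)) →
    r ≈ ⨅ s → (r ≈ closure r) × (r ∈ ℛ₂)) ×
  -- 2
  (Σ[ ⊓-closed ∈ (∀ {r₁ r₂} → r₁ ∈ ℛ₂ → r₂ ∈ ℛ₂ → (r₁ ⊓ r₂) ∈ ℛ₂) ]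
  -- 3
   Σ[ ⊔₂-closed ∈ (∀ {r₁ r₂} → r₁ ∈ ℛ₂ → r₂ ∈ ℛ₂ → join₂ r₁ r₂ ∈ ℛ₂) ]
   Supremum _⊑₂_ (liftOp₂ join₂ ⊔₂-closed) ×
  -- 4
   (Σ[ ↾₂-closed ∈ (∀ {r} → r ∈ ℛ₂ → ∀ Y → restrict₂ r Y ∈ ℛ₂) ]
    (∀ {r} → r ∈ ℛ₂ → ∀ Y →
      (r ↾ Y ⊑ restrict₂ r Y) ×
      (∀ {s} → s ∈ ℛ₂ → r ↾ Y ⊑ s → restrict₂ r Y ⊑ s)) ×
  -- 5
    (let _⊔₂_ = liftOp₂ join₂ ⊔₂-closed
         _⊓₂_ = liftOp₂ _⊓_ ⊓-closed
         _↾₂_ = liftRestriction₂ restrict₂ ↾₂-closed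
     in
     ∃[ ⊤₂ ] ∃[ ⊥₂ ]
       (IsRelationalDomain _≈₂_ _⊑₂_ _⊔₂_ _⊓₂_ ⊤₂ ⊥₂ _↾₂_ ×
        IsTwoDecomposable _≈₂_ _⊔₂_ _↾₂_ _⊓₂_ ⊤₂))))
theorem1 R ↾-⊔ =
  (λ r s s∈ r≈⨅s → let r≈r̅ = closure-of-meet r s s∈ r≈⨅s in r≈r̅ , r , r≈r̅) ,
  ⊓-closed ,
  join₂-closed ,
  supremum₂ ,
  (restrict₂-closed ,
    (λ {r} _ Y → ↾⊑restrict₂ r Y , restrict₂-least Y) ,
    ⊤₂ , ⊥₂ , isRelationalDomain₂ , isTwoDecomposable₂)
  where open Joins R ↾-⊔
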